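{- Let $s\ge0$ be an integer, $h\in\mathbb C\setminus\{0\}$ and $q\in\mathbb C\setminus\{0,1\}$. For all $0\le k\le n$, $$S_{s,h,q}[n,k]=h^{n-k}(1-q)^{k-n}\sum_{k\le t_1\le t_2\le t_3\le n}(-1)^{t_3-t_2+t_1-k}\,q^{(s-1)\binom{t_1-k}2-(s-1)\binom{t_1}2+s\binom{t_3}2}\binom{t_3}{t_2}\binom{t_2}{t_1}\genfrac{[}{]}{0pt}{}{n}{t_3}_{q^s}\genfrac{[}{]}{0pt}{}{t_1}{k}_{q^{s-1}}.$$
   Context: For an integer $x$, $[x]_q=\frac{q^x-1}{q-1}$ for $q\ne1$ (and $[x]_1=x$). The numbers $S_{s,h,q}[n,k]$ are the coefficients in $(VU)^n=\sum_{k=0}^nS_{s,h,q}[n,k]V^{sn-(s-1)k}U^k$, where $UV-qVU=hV^s$; equivalently they are determined by $S_{s,h,q}[n,k]=q^{s(n-1)-(s-1)(k-1)}S_{s,h,q}[n-1,k-1]+h[s(n-1)-(s-1)k]_q\,S_{s,h,q}[n-1,k]$ for $n,k\ge1$, with $S_{s,h,q}[n,0]=S_{s,h,q}[0,n]=\delta_{0,n}$. For $0\le k\le n$, $\genfrac{[}{]}{0pt}{}{n}{k}_p$ is the Gaussian ($p$-binomial) coefficient $\frac{[n]_p!}{[k]_p!\,[n-k]_p!}$, with $[n]_p!=[n]_p[n-1]_p\cdots[1]_p$, understood as a polynomial in $p$ evaluated at the given value (so it is the ordinary binomial coefficient at $p=1$). -}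

module Defs where

open import Algebra.Apartness.Bundles using (HeytingCommutativeRing; HeytingField)
open import Algebra.Bundles using (CommutativeRing; Semiring)
open import Data.Fin.Base using (toℕ)
open import Data.Integer.Base as ℤ using (ℤ; +_; -[1+_])
open import Data.Nat.Base as ℕ using (ℕ; zero; suc; _∸_)
open import Data.Product.Base using (_,_; proj₁)
import Algebra.Apartness.Properties.HeytingCommutativeRing
import Algebra.Definitions.RawSemiring
import Algebra.Properties.CommutativeSemigroup
import Data.Nat.Properties as ℕ
import Relation.Binary.PropositionalEquality.Core as ≡
import Relation.Binary.Reasoning.Setoid

module GaussianCoefficients {c ℓ} (R : CommutativeRing c ℓ) where

  open CommutativeRing R
  open Algebra.Definitions.RawSemiring (Semiring.rawSemiring semiring) using (_^_)

  -- 1 + p + … + pⁿ⁻¹, i.e. (pⁿ - 1) / (p - 1) as a polynomial in p.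
  qNat : Carrier → ℕ → Carrier
  qNat p zero    = 0#
  qNat p (suc n) = 1# + p * qNat p n

  qFact : Carrier → ℕ → Carrier
  qFact p zero    = 1#
  qFact p (suc n) = qNat p (suc n) * qFact p n

  -- The polynomial [n]! / ([k]! [n-k]!), evaluated at p.  The factorials may
  -- vanish at p, so the quotient is given by the p-Pascal rule, which is a
  -- polynomial in p.  gauss-quotient shows that it is the quotient: read in
  -- ℤ[p], it determines the polynomial because the factorials are monic.
  gauss : Carrier → ℕ → ℕ → Carrier
  gauss p n       zero    = 1#
  gauss p zero    (suc k) = 0#
  gauss p (suc n) (suc k) = gauss p n k + p ^ suc k * gauss p n (suc k)

  private
    open Relation.Binary.Reasoning.Setoid setoid
    open Algebra.Properties.CommutativeSemigroup *-commutativeSemigroup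
      using (x∙yz≈y∙xz)

    gauss-above : ∀ p n j → gauss p n (suc (n ℕ.+ j)) ≈ 0#
    gauss-above p zero    j = refl
    gauss-above p (suc n) j = begin
      gauss p n (suc (n ℕ.+ j)) + p ^ suc (suc n ℕ.+ j) * gauss p n (suc (suc (n ℕ.+ j)))
        ≈⟨ +-cong (gauss-above p n j)
                  (*-congˡ (trans (reflexive (≡.cong (λ m → gauss p n (suc m)) (≡.sym (ℕ.+-suc n j)))) (gauss-above p n (suc j)))) ⟩
      0# + p ^ suc (suc n ℕ.+ j) * 0#
        ≈⟨ trans (+-identityˡ _) (zeroʳ _) ⟩
      0# ∎

    qNat-+ : ∀ p k j → qNat p (k ℕ.+ j) ≈ qNat p k + p ^ k * qNat p j
    qNat-+ p zero    j = sym (trans (+-identityˡ _) (*-identityˡ _))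
    qNat-+ p (suc k) j = begin
      1# + p * qNat p (k ℕ.+ j)                         ≈⟨ +-congˡ (*-congˡ (qNat-+ p k j)) ⟩
      1# + p * (qNat p k + p ^ k * qNat p j)            ≈⟨ +-congˡ (distribˡ _ _ _) ⟩
      1# + (p * qNat p k + p * (p ^ k * qNat p j))      ≈⟨ +-congˡ (+-congˡ (*-assoc _ _ _)) ⟨
      1# + (p * qNat p k + p ^ suc k * qNat p j)        ≈⟨ +-assoc _ _ _ ⟨
      (1# + p * qNat p k) + p ^ suc k * qNat p j        ∎

  gauss-quotient : ∀ p k j →
    gauss p (k ℕ.+ j) k * (qFact p k * qFact p j) ≈ qFact p (k ℕ.+ j)
  gauss-quotient p zero    j = trans (*-identityˡ _) (*-identityˡ _)
  gauss-quotient p (suc k) j = begin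
    (gauss p n k + p ^ suc k * gauss p n (suc k)) * (qFact p (suc k) * qFact p j)
      ≈⟨ distribʳ _ _ _ ⟩
    gauss p n k * (qFact p (suc k) * qFact p j)
      + (p ^ suc k * gauss p n (suc k)) * (qFact p (suc k) * qFact p j)
      ≈⟨ +-cong left (trans (*-assoc _ _ _) (trans (*-congˡ (right j)) (sym (*-assoc _ _ _)))) ⟩
    qNat p (suc k) * qFact p n + (p ^ suc k * qNat p j) * qFact p n
      ≈⟨ distribʳ _ _ _ ⟨
    (qNat p (suc k) + p ^ suc k * qNat p j) * qFact p n
      ≈⟨ *-congʳ (qNat-+ p (suc k) j) ⟨
    qFact p (suc n) ∎
    where
    n : ℕ
    n = k ℕ.+ j

    left : gauss p n k * (qFact p (suc k) * qFact p j) ≈ qNat p (suc k) * qFact p n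
    left = begin
      gauss p n k * ((qNat p (suc k) * qFact p k) * qFact p j) ≈⟨ *-congˡ (*-assoc _ _ _) ⟩
      gauss p n k * (qNat p (suc k) * (qFact p k * qFact p j)) ≈⟨ x∙yz≈y∙xz _ _ _ ⟩
      qNat p (suc k) * (gauss p n k * (qFact p k * qFact p j)) ≈⟨ *-congˡ (gauss-quotient p k j) ⟩
      qNat p (suc k) * qFact p n                               ∎

    right : ∀ j → gauss p (k ℕ.+ j) (suc k) * (qFact p (suc k) * qFact p j)
                  ≈ qNat p j * qFact p (k ℕ.+ j)
    right zero = begin
      gauss p (k ℕ.+ 0) (suc k) * (qFact p (suc k) * 1#)
        ≈⟨ *-congʳ (trans (reflexive (≡.cong₂ (λ a b → gauss p a (suc b)) (ℕ.+-identityʳ k)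
                                                (≡.sym (ℕ.+-identityʳ k))))
                          (gauss-above p k 0)) ⟩
      0# * (qFact p (suc k) * 1#)  ≈⟨ zeroˡ _ ⟩
      0#                           ≈⟨ zeroˡ _ ⟨
      0# * qFact p (k ℕ.+ 0)       ∎
    right (suc i) = begin
      gauss p (k ℕ.+ suc i) (suc k) * (qFact p (suc k) * (qNat p (suc i) * qFact p i))
        ≈⟨ *-congˡ (x∙yz≈y∙xz _ _ _) ⟩
      gauss p (k ℕ.+ suc i) (suc k) * (qNat p (suc i) * (qFact p (suc k) * qFact p i))
        ≈⟨ x∙yz≈y∙xz _ _ _ ⟩
      qNat p (suc i) * (gauss p (k ℕ.+ suc i) (suc k) * (qFact p (suc k) * qFact p i))
        ≈⟨ *-congˡ (*-congʳ (reflexive (≡.cong (λ m → gauss p m (suc k)) (ℕ.+-suc k i)))) ⟩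
      qNat p (suc i) * (gauss p (suc k ℕ.+ i) (suc k) * (qFact p (suc k) * qFact p i))
        ≈⟨ *-congˡ (gauss-quotient p (suc k) i) ⟩
      qNat p (suc i) * qFact p (suc k ℕ.+ i)
        ≈⟨ *-congˡ (reflexive (≡.cong (qFact p) (ℕ.+-suc k i))) ⟨
      qNat p (suc i) * qFact p (k ℕ.+ suc i) ∎

-- ℂ is unavailable, so everything is done over an arbitrary field.  In a
-- Heyting field, x # y ("x - y is invertible") plays the role of x ≠ y.
module OverField {c ℓ₁ ℓ₂} (F : HeytingField c ℓ₁ ℓ₂) where

  open HeytingField F
  open HeytingCommutativeRing heytingCommutativeRing using (commutativeRing)
  open CommutativeRing commutativeRing using (semiring)
  open Algebra.Apartness.Properties.HeytingCommutativeRing heytingCommutativeRing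
    using (x-0≈x; invertibleˡ⇒#)
  open Algebra.Definitions.RawSemiring (Semiring.rawSemiring semiring) public using (_^_; _×_; sum)
  open GaussianCoefficients commutativeRing public using (gauss)

  #⇒-#0 : ∀ {x y} → x # y → x - y # 0#
  #⇒-#0 x#y with #⇒invertible x#y
  ... | i , i*[x-y]≈1 , _ = invertibleˡ⇒# (i , trans (*-congˡ (x-0≈x _)) i*[x-y]≈1)

  -- #⇒invertible yields an inverse of x - 0#, which equals x.
  inverse : ∀ x → x # 0# → Carrier
  inverse x x#0 = proj₁ (#⇒invertible x#0)

  zpow : ∀ x → x # 0# → ℤ → Carrier
  zpow x x#0 (+ n)    = x ^ n
  zpow x x#0 -[1+ n ] = inverse x x#0 ^ suc n

  sumFromTo : ℕ → ℕ → (ℕ → Carrier) → Carrier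
  sumFromTo a b f = sum {suc b ∸ a} (λ i → f (a ℕ.+ toℕ i))

  infix 5 sumFromTo
  syntax sumFromTo a b (λ t → e) = Σ[ a ≤ t ≤ b ] e

  qInt : ∀ q → q # 0# → q # 1# → ℤ → Carrier
  qInt q q#0 q#1 x = (zpow q q#0 x - 1#) * inverse (q - 1#) (#⇒-#0 q#1)

  -- The normal ordering coefficients of (VU)ⁿ, where UV - qVU = hVˢ.
  -- With N = suc n and K = suc k, the exponent s(N-1) - (s-1)(K-1) is
  -- sn - (s-1)k, and the bracket is [s(N-1) - (s-1)K] = [sn - (s-1)(k+1)].
  S : (s : ℕ) (h q : Carrier) → q # 0# → q # 1# → ℕ → ℕ → Carrier
  S s h q q#0 q#1 zero    zero    = 1#
  S s h q q#0 q#1 zero    (suc k) = 0#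
  S s h q q#0 q#1 (suc n) zero    = 0#
  S s h q q#0 q#1 (suc n) (suc k) =
      zpow q q#0 (+ s ℤ.* + n ℤ.- (+ s ℤ.- + 1) ℤ.* + k) * S s h q q#0 q#1 n k
    + h * qInt q q#0 q#1 (+ s ℤ.* + n ℤ.- (+ s ℤ.- + 1) ℤ.* + suc k) * S s h q q#0 q#1 n (suc k)

-- Put p = q^s, r = q^(s-1).  Summing over t₂ in the triple sum is binomial
-- inversion, which forces t₁ = t₃ and leaves
--   W(n,k) = Σ_t p^(t C 2) [n t]_p · (-1)^(t-k) r^((t-k) C 2 - t C 2) [t k]_r .
-- Both factors are coefficients of products ∏_{i<n} (σ + p^i x), with parameters
-- (p, 1) and (1/r, -1).  Comparing the two Pascal rules of such coefficients (drop
-- the last factor, or drop the first one and rescale x) gives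
--   W(n+1,k+1) = W(n,k+1) + p^n (r^-k W(n,k) - r^-(k+1) W(n,k+1)),
-- which is the recurrence of S once the powers of h/(1-q) are extracted.
module Submission where

open import Defs
open import Algebra.Apartness.Bundles using (HeytingCommutativeRing; HeytingField)
open import Algebra.Bundles using (CommutativeRing; Semiring)
open import Data.Fin.Base using (toℕ)
open import Data.Integer.Base as ℤ using (ℤ; +_; -[1+_])
open import Data.Nat.Base as ℕ using (ℕ; zero; suc; _∸_; z≤n; s≤s)
open import Data.Nat.Combinatorics using (_C_; k>n⇒nCk≡0; nC1≡n; nCk+nC[k+1]≡[n+1]C[k+1])
open import Data.Product.Base using (proj₂)
open import Data.Sum.Base using (_⊎_; inj₁; inj₂)
open import Function.Base using (_∘_)
import Algebra.Apartness.Properties.HeytingCommutativeRing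
import Algebra.Definitions.RawSemiring
import Algebra.Properties.CommutativeSemiring.Exp
import Algebra.Properties.Ring
import Algebra.Properties.Semiring.Mult
import Algebra.Solver.Ring.NaturalCoefficients.Default
import Data.Integer.Properties as ℤ
import Data.Nat.Properties as ℕ
import Relation.Binary.PropositionalEquality.Core as ≡
import Relation.Binary.Reasoning.Setoid

[1+k]C2≡k+kC2 : ∀ k → suc k C 2 ≡.≡ k ℕ.+ (k C 2)
[1+k]C2≡k+kC2 k = ≡.trans (≡.sym (nCk+nC[k+1]≡[n+1]C[k+1] k 1)) (≡.cong (ℕ._+ (k C 2)) (nC1≡n k))

module ProductCoefficients {c ℓ} (R : CommutativeRing c ℓ) where

  open CommutativeRing R hiding (zero)
  open Algebra.Definitions.RawSemiring (Semiring.rawSemiring semiring) using (sum; _×_)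
  open Algebra.Properties.CommutativeSemiring.Exp commutativeSemiring
  open Algebra.Properties.Semiring.Mult semiring using (×-homo-+; ×-congˡ)
  open Algebra.Solver.Ring.NaturalCoefficients.Default commutativeSemiring
    using (solve; _:=_; _:+_; _:*_; con)
  open GaussianCoefficients R using (gauss)
  open Relation.Binary.Reasoning.Setoid setoid

  -- Opaque so that the summand can be inferred.
  opaque

    ∑< : ℕ → (ℕ → Carrier) → Carrier
    ∑< n f = sum {n} (λ i → f (toℕ i))

    ∑<-suc : ∀ n f → ∑< (suc n) f ≈ f 0 + ∑< n (f ∘ suc)
    ∑<-suc n f = refl

    sum≈∑< : ∀ n f → sum {n} (λ i → f (toℕ i)) ≈ ∑< n f
    sum≈∑< n f = refl

    ∑<-cong : ∀ n {f g} → (∀ t → t ℕ.< n → f t ≈ g t) → ∑< n f ≈ ∑< n g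
    ∑<-cong zero    f≈g = refl
    ∑<-cong (suc n) f≈g = +-cong (f≈g 0 (s≤s z≤n)) (∑<-cong n (λ t t<n → f≈g (suc t) (s≤s t<n)))

    ∑<-zero : ∀ n {f} → (∀ t → t ℕ.< n → f t ≈ 0#) → ∑< n f ≈ 0#
    ∑<-zero zero    f≈0 = refl
    ∑<-zero (suc n) f≈0 =
      trans (+-cong (f≈0 0 (s≤s z≤n)) (∑<-zero n (λ t t<n → f≈0 (suc t) (s≤s t<n)))) (+-identityˡ 0#)

    ∑<-linear : ∀ n x y f g → ∑< n (λ t → x * f t + y * g t) ≈ x * ∑< n f + y * ∑< n g
    ∑<-linear zero    x y f g = sym (trans (+-cong (zeroʳ x) (zeroʳ y)) (+-identityˡ 0#))
    ∑<-linear (suc n) x y f g = trans (+-congˡ (∑<-linear n x y (f ∘ suc) (g ∘ suc)))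
      (solve 6 (λ x y a b c d → (x :* a :+ y :* b) :+ (x :* c :+ y :* d)
                                := x :* (a :+ c) :+ y :* (b :+ d)) refl
         x y (f 0) (g 0) (∑< n (f ∘ suc)) (∑< n (g ∘ suc)))

    *-distribˡ-∑< : ∀ n x f → x * ∑< n f ≈ ∑< n (λ t → x * f t)
    *-distribˡ-∑< zero    x f = zeroʳ x
    *-distribˡ-∑< (suc n) x f = trans (distribˡ x _ _) (+-congˡ (*-distribˡ-∑< n x (f ∘ suc)))

    ∑<-last : ∀ n f → ∑< (suc n) f ≈ ∑< n f + f n
    ∑<-last zero    f = trans (+-identityʳ _) (sym (+-identityˡ _))
    ∑<-last (suc n) f = trans (+-congˡ (∑<-last n (f ∘ suc))) (sym (+-assoc _ _ _))

    ∑<-drop : ∀ m n f → (∀ t → t ℕ.< m → f t ≈ 0#) → ∑< (m ℕ.+ n) f ≈ ∑< n (λ t → f (m ℕ.+ t))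
    ∑<-drop zero    n f f≈0 = refl
    ∑<-drop (suc m) n f f≈0 =
      trans (+-cong (f≈0 0 (s≤s z≤n)) (∑<-drop m n (f ∘ suc) (λ t t<m → f≈0 (suc t) (s≤s t<m))))
            (+-identityˡ _)

  1^n≈1 : ∀ n → 1# ^ n ≈ 1#
  1^n≈1 zero    = refl
  1^n≈1 (suc n) = trans (*-identityˡ _) (1^n≈1 n)

  ^-∸-suc : ∀ x {y} n k → (n ℕ.≤ k → y ≈ 0#) → x ^ (n ∸ k) * y ≈ x * (x ^ (n ∸ suc k) * y)
  ^-∸-suc x {y} n k y≈0 with ℕ.≤-<-connex n k
  ... | inj₁ n≤k = trans (trans (*-congˡ (y≈0 n≤k)) (zeroʳ _))
                         (sym (trans (*-congˡ (trans (*-congˡ (y≈0 n≤k)) (zeroʳ _))) (zeroʳ _)))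
  ... | inj₂ k<n = trans (*-congʳ (^-congʳ x (ℕ.+-∸-assoc 1 k<n))) (*-assoc _ _ _)

  -- The coefficient of x^k in ∏_{i<n} (σ + p^i x).
  coeff : Carrier → Carrier → ℕ → ℕ → Carrier
  coeff p σ zero    zero    = 1#
  coeff p σ zero    (suc k) = 0#
  coeff p σ (suc n) zero    = σ * coeff p σ n zero
  coeff p σ (suc n) (suc k) = p ^ n * coeff p σ n k + σ * coeff p σ n (suc k)

  coeff-above : ∀ p σ n k → n ℕ.< k → coeff p σ n k ≈ 0#
  coeff-above p σ zero    (suc k) _         = refl
  coeff-above p σ (suc n) (suc k) (s≤s n<k) = begin
    p ^ n * coeff p σ n k + σ * coeff p σ n (suc k)
      ≈⟨ +-cong (*-congˡ (coeff-above p σ n k n<k)) (*-congˡ (coeff-above p σ n (suc k) (ℕ.m<n⇒m<1+n n<k))) ⟩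
    p ^ n * 0# + σ * 0#  ≈⟨ +-cong (zeroʳ _) (zeroʳ _) ⟩
    0# + 0#              ≈⟨ +-identityˡ 0# ⟩
    0#                   ∎

  gauss-above : ∀ p n k → n ℕ.< k → gauss p n k ≈ 0#
  gauss-above p zero    (suc k) _         = refl
  gauss-above p (suc n) (suc k) (s≤s n<k) =
    trans (+-cong (gauss-above p n k n<k)
                  (trans (*-congˡ (gauss-above p n (suc k) (ℕ.m<n⇒m<1+n n<k))) (zeroʳ _)))
          (+-identityˡ 0#)

  coeff-pascal : ∀ p σ n k →
    coeff p σ (suc n) (suc k) ≈ p ^ k * coeff p σ n k + (σ * p ^ suc k) * coeff p σ n (suc k)
  coeff-pascal p σ zero zero = +-congˡ (trans (zeroʳ _) (sym (zeroʳ _)))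
  coeff-pascal p σ zero (suc k) =
    trans (+-cong (zeroʳ _) (zeroʳ _)) (sym (+-cong (zeroʳ _) (zeroʳ _)))
  coeff-pascal p σ (suc n) zero =
    trans (+-congˡ (*-congˡ (coeff-pascal p σ n zero)))
      (solve 5 (λ p σ q a b →
         (p :* q) :* (σ :* a) :+ σ :* (con 1 :* a :+ (σ :* (p :* con 1)) :* b)
         := con 1 :* (σ :* a) :+ (σ :* (p :* con 1)) :* (q :* a :+ σ :* b)) refl
         p σ (p ^ n) (coeff p σ n 0) (coeff p σ n 1))
  coeff-pascal p σ (suc n) (suc k) =
    trans (+-cong (*-congˡ (coeff-pascal p σ n k)) (*-congˡ (coeff-pascal p σ n (suc k))))
      (solve 7 (λ p σ q r a b c →
         (p :* q) :* (r :* a :+ (σ :* (p :* r)) :* b)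
           :+ σ :* ((p :* r) :* b :+ (σ :* (p :* (p :* r))) :* c)
         := (p :* r) :* (q :* a :+ σ :* b) :+ (σ :* (p :* (p :* r))) :* (q :* b :+ σ :* c)) refl
         p σ (p ^ n) (p ^ k) (coeff p σ n k) (coeff p σ n (suc k)) (coeff p σ n (suc (suc k))))

  coeff-0 : ∀ p σ n → coeff p σ n 0 ≈ σ ^ n
  coeff-0 p σ zero    = refl
  coeff-0 p σ (suc n) = *-congˡ (coeff-0 p σ n)

  coeff≈gauss : ∀ p σ n k → coeff p σ n k ≈ σ ^ (n ∸ k) * (p ^ (k C 2) * gauss p n k)
  coeff≈gauss p σ n zero = begin
    coeff p σ n 0          ≈⟨ coeff-0 p σ n ⟩
    σ ^ n                  ≈⟨ *-identityʳ _ ⟨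
    σ ^ n * 1#             ≈⟨ *-congˡ (*-identityˡ 1#) ⟨
    σ ^ n * (1# * 1#)      ≡⟨⟩
    σ ^ n * (p ^ (0 C 2) * gauss p n 0) ∎
  coeff≈gauss p σ zero (suc k) = sym (trans (*-congˡ (zeroʳ _)) (zeroʳ _))
  coeff≈gauss p σ (suc n) (suc k) = begin
    coeff p σ (suc n) (suc k)
      ≈⟨ coeff-pascal p σ n k ⟩
    p ^ k * coeff p σ n k + (σ * p ^ suc k) * coeff p σ n (suc k)
      ≈⟨ +-cong (*-congˡ (coeff≈gauss p σ n k)) (*-congˡ (coeff≈gauss p σ n (suc k))) ⟩
    p ^ k * (σ ^ (n ∸ k) * (p ^ (k C 2) * G)) + (σ * p ^ suc k) * (σ ^ (n ∸ suc k) * (p ^ (suc k C 2) * G′))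
      ≈⟨ +-congˡ (solve 5 (λ σ a b e g → (σ :* a) :* (b :* (e :* g)) := (a :* e) :* (σ :* (b :* g)))
                    refl σ (p ^ suc k) (σ ^ (n ∸ suc k)) (p ^ (suc k C 2)) G′) ⟩
    p ^ k * (σ ^ (n ∸ k) * (p ^ (k C 2) * G)) + (p ^ suc k * p ^ (suc k C 2)) * (σ * (σ ^ (n ∸ suc k) * G′))
      ≈⟨ +-congˡ (*-congˡ (^-∸-suc σ n k (λ n≤k → gauss-above p n (suc k) (s≤s n≤k)))) ⟨
    p ^ k * (σ ^ (n ∸ k) * (p ^ (k C 2) * G)) + (p ^ suc k * p ^ (suc k C 2)) * (σ ^ (n ∸ k) * G′)
      ≈⟨ +-congˡ (*-congʳ (*-congˡ pow)) ⟩
    p ^ k * (σ ^ (n ∸ k) * (p ^ (k C 2) * G)) + (p ^ suc k * (p ^ k * p ^ (k C 2))) * (σ ^ (n ∸ k) * G′)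
      ≈⟨ solve 6 (λ a a′ b e g g′ → a :* (b :* (e :* g)) :+ (a′ :* (a :* e)) :* (b :* g′)
                                    := b :* ((a :* e) :* (g :+ a′ :* g′)))
           refl (p ^ k) (p ^ suc k) (σ ^ (n ∸ k)) (p ^ (k C 2)) G G′ ⟩
    σ ^ (n ∸ k) * ((p ^ k * p ^ (k C 2)) * (G + p ^ suc k * G′))
      ≈⟨ *-congˡ (*-congʳ pow) ⟨
    σ ^ (n ∸ k) * (p ^ (suc k C 2) * (G + p ^ suc k * G′)) ∎
    where
    G  = gauss p n k
    G′ = gauss p n (suc k)
    pow : p ^ (suc k C 2) ≈ p ^ k * p ^ (k C 2)
    pow = trans (^-congʳ p ([1+k]C2≡k+kC2 k)) (^-homo-* p k (k C 2))

  coeff-1≈C : ∀ σ n k → coeff 1# σ n k ≈ σ ^ (n ∸ k) * ((n C k) × 1#)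
  coeff-1≈C σ n zero =
    trans (coeff-0 1# σ n) (sym (trans (*-congˡ (+-identityʳ 1#)) (*-identityʳ _)))
  coeff-1≈C σ zero    (suc k) = sym (zeroʳ _)
  coeff-1≈C σ (suc n) (suc k) = begin
    1# ^ n * coeff 1# σ n k + σ * coeff 1# σ n (suc k)
      ≈⟨ +-cong (*-cong (1^n≈1 n) (coeff-1≈C σ n k)) (*-congˡ (coeff-1≈C σ n (suc k))) ⟩
    1# * (σ ^ (n ∸ k) * B) + σ * (σ ^ (n ∸ suc k) * B′)
      ≈⟨ +-cong (*-identityˡ _) (sym (^-∸-suc σ n k (λ n≤k → ×-congˡ (k>n⇒nCk≡0 (s≤s n≤k))))) ⟩
    σ ^ (n ∸ k) * B + σ ^ (n ∸ k) * B′
      ≈⟨ distribˡ _ _ _ ⟨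
    σ ^ (n ∸ k) * (B + B′)
      ≈⟨ *-congˡ (×-homo-+ 1# (n C k) (n C suc k)) ⟨
    σ ^ (n ∸ k) * (((n C k) ℕ.+ (n C suc k)) × 1#)
      ≈⟨ *-congˡ (×-congˡ (nCk+nC[k+1]≡[n+1]C[k+1] n k)) ⟩
    σ ^ (n ∸ k) * ((suc n C suc k) × 1#) ∎
    where
    B  = (n C k) × 1#
    B′ = (n C suc k) × 1#

  ^-inverse : ∀ {x y} → x * y ≈ 1# → ∀ n → x ^ n * y ^ n ≈ 1#
  ^-inverse {x} {y} xy≈1 n = trans (sym (^-distrib-* x y n)) (trans (^-congˡ n xy≈1) (1^n≈1 n))

  coeff-inverse≈gauss : ∀ {r ρ} → r * ρ ≈ 1# → ∀ σ n k →
    coeff ρ σ n k ≈ σ ^ (n ∸ k) * (r ^ ((n ∸ k) C 2) * ρ ^ (n C 2) * gauss r n k)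
  coeff-inverse≈gauss {r} {ρ} rρ≈1 σ n zero = begin
    coeff ρ σ n 0                                   ≈⟨ coeff-0 ρ σ n ⟩
    σ ^ n                                           ≈⟨ *-identityʳ _ ⟨
    σ ^ n * 1#                                      ≈⟨ *-congˡ (^-inverse rρ≈1 (n C 2)) ⟨
    σ ^ n * (r ^ (n C 2) * ρ ^ (n C 2))             ≈⟨ *-congˡ (*-identityʳ _) ⟨
    σ ^ n * (r ^ (n C 2) * ρ ^ (n C 2) * 1#)        ∎
  coeff-inverse≈gauss rρ≈1 σ zero (suc k) = sym (trans (*-congˡ (zeroʳ _)) (zeroʳ _))
  coeff-inverse≈gauss {r} {ρ} rρ≈1 σ (suc n) (suc k) = begin
    ρ ^ n * coeff ρ σ n k + σ * coeff ρ σ n (suc k)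
      ≈⟨ +-cong (*-congˡ (coeff-inverse≈gauss rρ≈1 σ n k)) (*-congˡ (coeff-inverse≈gauss rρ≈1 σ n (suc k))) ⟩
    ρ ^ n * (s * (a * b * G)) + σ * (σ ^ (n ∸ suc k) * (r ^ ((n ∸ suc k) C 2) * b * G′))
      ≈⟨ +-congˡ (shifted (ℕ.≤-<-connex n k)) ⟩
    ρ ^ n * (s * (a * b * G)) + s * (a * (ρ ^ n * b) * (r ^ suc k * G′))
      ≈⟨ solve 6 (λ x s a b g y → x :* (s :* (a :* b :* g)) :+ s :* (a :* (x :* b) :* y)
                                  := s :* (a :* (x :* b) :* (g :+ y)))
           refl (ρ ^ n) s a b G (r ^ suc k * G′) ⟩
    s * (a * (ρ ^ n * b) * (G + r ^ suc k * G′))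
      ≈⟨ *-congˡ (*-congʳ (*-congˡ (trans (^-congʳ ρ ([1+k]C2≡k+kC2 n)) (^-homo-* ρ n (n C 2))))) ⟨
    s * (a * ρ ^ (suc n C 2) * (G + r ^ suc k * G′)) ∎
    where
    G  = gauss r n k
    G′ = gauss r n (suc k)
    s  = σ ^ (n ∸ k)
    a  = r ^ ((n ∸ k) C 2)
    b  = ρ ^ (n C 2)

    shifted : n ℕ.≤ k ⊎ k ℕ.< n →
      σ * (σ ^ (n ∸ suc k) * (r ^ ((n ∸ suc k) C 2) * b * G′)) ≈ s * (a * (ρ ^ n * b) * (r ^ suc k * G′))
    shifted (inj₁ n≤k) = trans
      (trans (*-congˡ (trans (*-congˡ (trans (*-congˡ G′≈0) (zeroʳ _))) (zeroʳ _))) (zeroʳ _))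
      (sym (trans (*-congˡ (trans (*-congˡ (trans (*-congˡ G′≈0) (zeroʳ _))) (zeroʳ _))) (zeroʳ _)))
      where
      G′≈0 = gauss-above r n (suc k) (s≤s n≤k)
    shifted (inj₂ k<n) = begin
      σ * (σ ^ j * (r ^ (j C 2) * b * G′))
        ≈⟨ *-identityˡ _ ⟨
      1# * (σ * (σ ^ j * (r ^ (j C 2) * b * G′)))
        ≈⟨ *-congʳ (^-inverse rρ≈1 n) ⟨
      (r ^ n * ρ ^ n) * (σ * (σ ^ j * (r ^ (j C 2) * b * G′)))
        ≈⟨ *-congʳ (*-congʳ (trans (^-congʳ r (≡.sym (ℕ.m∸n+n≡m k<n))) (^-homo-* r j (suc k)))) ⟩
      ((r ^ j * r ^ suc k) * ρ ^ n) * (σ * (σ ^ j * (r ^ (j C 2) * b * G′)))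
        ≈⟨ solve 8 (λ x y z σ s a b g → ((x :* y) :* z) :* (σ :* (s :* (a :* b :* g)))
                                        := (σ :* s) :* ((x :* a) :* (z :* b) :* (y :* g)))
             refl (r ^ j) (r ^ suc k) (ρ ^ n) σ (σ ^ j) (r ^ (j C 2)) b G′ ⟩
      σ ^ suc j * ((r ^ j * r ^ (j C 2)) * (ρ ^ n * b) * (r ^ suc k * G′))
        ≈⟨ *-cong (^-congʳ σ (≡.sym n∸k≡1+j)) (*-congʳ (*-congʳ (sym pow))) ⟩
      s * (a * (ρ ^ n * b) * (r ^ suc k * G′)) ∎
      where
      j = n ∸ suc k
      n∸k≡1+j : n ∸ k ≡.≡ suc j
      n∸k≡1+j = ℕ.+-∸-assoc 1 k<n
      pow : a ≈ r ^ j * r ^ (j C 2)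
      pow = trans (^-congʳ r (≡.trans (≡.cong (_C 2) n∸k≡1+j) ([1+k]C2≡k+kC2 j))) (^-homo-* r j (j C 2))

  transform : Carrier → Carrier → (ℕ → Carrier) → ℕ → Carrier
  transform p σ f n = ∑< (suc n) (λ t → coeff p σ n t * f t)

  transform-cong : ∀ p σ n {f g} → (∀ t → f t ≈ g t) → transform p σ f n ≈ transform p σ g n
  transform-cong p σ n f≈g = ∑<-cong (suc n) (λ t _ → *-congˡ (f≈g t))

  transform-zero : ∀ p σ n {f} → (∀ t → t ℕ.≤ n → f t ≈ 0#) → transform p σ f n ≈ 0#
  transform-zero p σ n f≈0 = ∑<-zero (suc n) λ { t (s≤s t≤n) → trans (*-congˡ (f≈0 t t≤n)) (zeroʳ _) }

  transform-* : ∀ p σ n x f → transform p σ (λ t → x * f t) n ≈ x * transform p σ f n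
  transform-* p σ n x f = trans
    (∑<-cong (suc n) (λ t _ → solve 3 (λ a x f → a :* (x :* f) := x :* (a :* f)) refl (coeff p σ n t) x (f t)))
    (sym (*-distribˡ-∑< (suc n) x _))

  transform-linear : ∀ p σ n x y f g →
    transform p σ (λ t → x * f t + y * g t) n ≈ x * transform p σ f n + y * transform p σ g n
  transform-linear p σ n x y f g = trans
    (∑<-cong (suc n) (λ t _ → solve 5 (λ a x y f g → a :* (x :* f :+ y :* g) := x :* (a :* f) :+ y :* (a :* g))
                                refl (coeff p σ n t) x y (f t) (g t)))
    (∑<-linear (suc n) x y _ _)

  transform-0 : ∀ p σ f → transform p σ f 0 ≈ f 0
  transform-0 p σ f = trans (∑<-last 0 _) (trans (+-cong (∑<-zero 0 λ _ ()) (*-identityˡ _)) (+-identityˡ _))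

  transform-suc : ∀ p σ f n →
    transform p σ f (suc n) ≈ σ * transform p σ f n + p ^ n * transform p σ (f ∘ suc) n
  transform-suc p σ f n = begin
    transform p σ f (suc n)
      ≈⟨ ∑<-suc (suc n) _ ⟩
    (σ * a 0) * f 0 + ∑< (suc n) (λ t → (p ^ n * a t + σ * a (suc t)) * f (suc t))
      ≈⟨ +-congˡ (∑<-cong (suc n) (λ t _ →
           solve 5 (λ x a σ b f → (x :* a :+ σ :* b) :* f := x :* (a :* f) :+ σ :* (b :* f))
             refl (p ^ n) (a t) σ (a (suc t)) (f (suc t)))) ⟩
    (σ * a 0) * f 0 + ∑< (suc n) (λ t → p ^ n * (a t * f (suc t)) + σ * (a (suc t) * f (suc t)))
      ≈⟨ +-congˡ (∑<-linear (suc n) (p ^ n) σ _ _) ⟩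
    (σ * a 0) * f 0 + (p ^ n * transform p σ (f ∘ suc) n + σ * ∑< (suc n) (λ t → a (suc t) * f (suc t)))
      ≈⟨ solve 6 (λ σ a f x t s → (σ :* a) :* f :+ (x :* t :+ σ :* s) := σ :* (a :* f :+ s) :+ x :* t)
           refl σ (a 0) (f 0) (p ^ n) (transform p σ (f ∘ suc) n) (∑< (suc n) (λ t → a (suc t) * f (suc t))) ⟩
    σ * (a 0 * f 0 + ∑< (suc n) (λ t → a (suc t) * f (suc t))) + p ^ n * transform p σ (f ∘ suc) n
      ≈⟨ +-congʳ (*-congˡ (trans (sym (∑<-suc (suc n) _)) (∑<-last (suc n) (λ t → a t * f t)))) ⟩
    σ * (transform p σ f n + a (suc n) * f (suc n)) + p ^ n * transform p σ (f ∘ suc) n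
      ≈⟨ +-congʳ (*-congˡ (trans (+-congˡ (trans (*-congʳ (coeff-above p σ n (suc n) ℕ.≤-refl)) (zeroˡ _))) (+-identityʳ _))) ⟩
    σ * transform p σ f n + p ^ n * transform p σ (f ∘ suc) n ∎
    where
    a : ℕ → Carrier
    a = coeff p σ n

  binomial-inversion : ∀ {σ τ} → σ + τ ≈ 0# → ∀ f n →
    transform 1# σ (transform 1# τ f) n ≈ f n
  binomial-inversion {σ} {τ} σ+τ≈0 f zero =
    trans (transform-0 1# σ (transform 1# τ f)) (transform-0 1# τ f)
  binomial-inversion {σ} {τ} σ+τ≈0 f (suc n) = begin
    transform 1# σ Tf (suc n)
      ≈⟨ transform-suc 1# σ Tf n ⟩
    σ * X + 1# ^ n * transform 1# σ (Tf ∘ suc) n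
      ≈⟨ +-congˡ (trans (*-congʳ (1^n≈1 n)) (*-identityˡ _)) ⟩
    σ * X + transform 1# σ (Tf ∘ suc) n
      ≈⟨ +-congˡ (transform-cong 1# σ n (λ t → trans (transform-suc 1# τ f t) (+-congˡ (*-congʳ (1^n≈1 t))))) ⟩
    σ * X + transform 1# σ (λ t → τ * Tf t + 1# * transform 1# τ (f ∘ suc) t) n
      ≈⟨ +-congˡ (transform-linear 1# σ n τ 1# _ _) ⟩
    σ * X + (τ * X + 1# * transform 1# σ (transform 1# τ (f ∘ suc)) n)
      ≈⟨ +-congˡ (+-congˡ (trans (*-identityˡ _) (binomial-inversion σ+τ≈0 (f ∘ suc) n))) ⟩
    σ * X + (τ * X + f (suc n))
      ≈⟨ solve 4 (λ σ τ x y → σ :* x :+ (τ :* x :+ y) := (σ :+ τ) :* x :+ y) refl σ τ X (f (suc n)) ⟩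
    (σ + τ) * X + f (suc n)
      ≈⟨ +-congʳ (trans (*-congʳ σ+τ≈0) (zeroˡ X)) ⟩
    0# + f (suc n)
      ≈⟨ +-identityˡ _ ⟩
    f (suc n) ∎
    where
    Tf = transform 1# τ f
    X  = transform 1# σ Tf n

  transform-from : ∀ p σ {k n} x (f g : ℕ → Carrier) → k ℕ.≤ n → (∀ t → t ℕ.< k → f t ≈ 0#) →
    (∀ t → k ℕ.≤ t → g t ≈ x * (coeff p σ n t * f t)) →
    sum {suc n ∸ k} (λ i → g (k ℕ.+ toℕ i)) ≈ x * transform p σ f n
  transform-from p σ {k} {n} x f g k≤n f≈0 g≈ = begin
    sum {suc n ∸ k} (λ i → g (k ℕ.+ toℕ i))
      ≈⟨ sum≈∑< (suc n ∸ k) (λ t → g (k ℕ.+ t)) ⟩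
    ∑< (suc n ∸ k) (λ t → g (k ℕ.+ t))
      ≈⟨ ∑<-cong (suc n ∸ k) (λ t _ → g≈ (k ℕ.+ t) (ℕ.m≤m+n k t)) ⟩
    ∑< (suc n ∸ k) (λ t → x * (coeff p σ n (k ℕ.+ t) * f (k ℕ.+ t)))
      ≈⟨ *-distribˡ-∑< (suc n ∸ k) x _ ⟨
    x * ∑< (suc n ∸ k) (λ t → coeff p σ n (k ℕ.+ t) * f (k ℕ.+ t))
      ≈⟨ *-congˡ (∑<-drop k (suc n ∸ k) (λ t → coeff p σ n t * f t)
           (λ t t<k → trans (*-congˡ (f≈0 t t<k)) (zeroʳ _))) ⟨
    x * ∑< (k ℕ.+ (suc n ∸ k)) (λ t → coeff p σ n t * f t)
      ≡⟨ ≡.cong (λ m → x * ∑< m (λ t → coeff p σ n t * f t)) (ℕ.m+[n∸m]≡n (ℕ.m≤n⇒m≤1+n k≤n)) ⟩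
    x * transform p σ f n ∎

  coeffProduct : Carrier → Carrier → Carrier → Carrier → ℕ → ℕ → Carrier
  coeffProduct p σ ρ τ n k = transform p σ (λ t → coeff ρ τ t k) n

  coeffProduct-suc-zero : ∀ p {σ} ρ {τ} → σ + τ ≈ 0# → ∀ n → coeffProduct p σ ρ τ (suc n) 0 ≈ 0#
  coeffProduct-suc-zero p {σ} ρ {τ} σ+τ≈0 = go
    where
    f : ℕ → Carrier
    f t = coeff ρ τ t 0
    factor : ∀ n → transform p σ f (suc n) ≈ (σ + p ^ n * τ) * transform p σ f n
    factor n = begin
      transform p σ f (suc n)                              ≈⟨ transform-suc p σ f n ⟩
      σ * X + p ^ n * transform p σ (λ t → τ * f t) n
        ≈⟨ +-congˡ (*-congˡ (transform-* p σ n τ f)) ⟩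
      σ * X + p ^ n * (τ * X)
        ≈⟨ solve 4 (λ σ q τ x → σ :* x :+ q :* (τ :* x) := (σ :+ q :* τ) :* x)
             refl σ (p ^ n) τ X ⟩
      (σ + p ^ n * τ) * X ∎
      where X = transform p σ f n
    go : ∀ n → transform p σ f (suc n) ≈ 0#
    go zero    = trans (factor 0) (trans (*-congʳ (trans (+-congˡ (*-identityˡ τ)) σ+τ≈0)) (zeroˡ _))
    go (suc n) = trans (factor (suc n)) (trans (*-congˡ (go n)) (zeroʳ _))

  coeffProduct-suc-suc : ∀ p σ ρ τ n k → coeffProduct p σ ρ τ (suc n) (suc k) ≈
    σ * coeffProduct p σ ρ τ n (suc k)
      + p ^ n * (ρ ^ k * coeffProduct p σ ρ τ n k + (τ * ρ ^ suc k) * coeffProduct p σ ρ τ n (suc k))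
  coeffProduct-suc-suc p σ ρ τ n k = trans (transform-suc p σ _ n)
    (+-congˡ (*-congˡ (trans (transform-cong p σ n (λ t → coeff-pascal ρ τ t k))
                             (transform-linear p σ n _ _ _ _))))

  coeffProduct-above : ∀ p σ ρ τ n k → n ℕ.< k → coeffProduct p σ ρ τ n k ≈ 0#
  coeffProduct-above p σ ρ τ n k n<k =
    transform-zero p σ n (λ t t≤n → coeff-above ρ τ t k (ℕ.≤-<-trans t≤n n<k))

module NormalOrdering {c ℓ₁ ℓ₂} (F : HeytingField c ℓ₁ ℓ₂) where

  open HeytingField F using (heytingCommutativeRing; _#_; #⇒invertible; #-sym)
  open HeytingCommutativeRing heytingCommutativeRing using (commutativeRing)
  open CommutativeRing commutativeRing hiding (zero)
  open Algebra.Apartness.Properties.HeytingCommutativeRing heytingCommutativeRing using (x-0≈x)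
  open Algebra.Properties.CommutativeSemiring.Exp commutativeSemiring using (^-homo-*; ^-congʳ; ^-distrib-*)
  open Algebra.Properties.Ring ring using (-1*x≈-x; -‿anti-homo-+; -‿involutive)
  open Algebra.Solver.Ring.NaturalCoefficients.Default commutativeSemiring
    using (solve; _:=_; _:+_; _:*_; con)
  open ProductCoefficients commutativeRing
  open OverField F
  open Relation.Binary.Reasoning.Setoid setoid

  *-inverseʳ : ∀ x x#0 → x * inverse x x#0 ≈ 1#
  *-inverseʳ x x#0 = trans (*-congʳ (sym (x-0≈x x))) (proj₂ (proj₂ (#⇒invertible x#0)))

  inverse-unique : ∀ x x#0 y → x * y ≈ 1# → inverse x x#0 ≈ y
  inverse-unique x x#0 y xy≈1 = begin
    u            ≈⟨ *-identityʳ u ⟨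
    u * 1#       ≈⟨ *-congˡ xy≈1 ⟨
    u * (x * y)  ≈⟨ solve 3 (λ u x y → u :* (x :* y) := (x :* u) :* y) refl u x y ⟩
    (x * u) * y  ≈⟨ *-congʳ (*-inverseʳ x x#0) ⟩
    1# * y       ≈⟨ *-identityˡ y ⟩
    y            ∎
    where u = inverse x x#0

  module _ (x : Carrier) (x#0 : x # 0#) where

    private
      u : Carrier
      u = inverse x x#0

      z : ℤ → Carrier
      z = zpow x x#0

    zpow-⊖ : ∀ m n → z (m ℤ.⊖ n) ≈ x ^ m * u ^ n
    zpow-⊖ zero    zero    = sym (*-identityʳ _)
    zpow-⊖ zero    (suc n) = sym (*-identityˡ _)
    zpow-⊖ (suc m) zero    = sym (*-identityʳ _)
    zpow-⊖ (suc m) (suc n) = begin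
      z (suc m ℤ.⊖ suc n)        ≡⟨ ≡.cong z (ℤ.[1+m]⊖[1+n]≡m⊖n m n) ⟩
      z (m ℤ.⊖ n)                ≈⟨ zpow-⊖ m n ⟩
      x ^ m * u ^ n              ≈⟨ *-identityˡ _ ⟨
      1# * (x ^ m * u ^ n)       ≈⟨ *-congʳ (*-inverseʳ x x#0) ⟨
      (x * u) * (x ^ m * u ^ n)
        ≈⟨ solve 4 (λ x u a b → (x :* u) :* (a :* b) := (x :* a) :* (u :* b)) refl x u (x ^ m) (u ^ n) ⟩
      x ^ suc m * u ^ suc n      ∎

    zpow-+ : ∀ i j → z (i ℤ.+ j) ≈ z i * z j
    zpow-+ (+ m)    (+ n)    = ^-homo-* x m n
    zpow-+ (+ m)    -[1+ n ] = zpow-⊖ m (suc n)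
    zpow-+ -[1+ m ] (+ n)    = trans (zpow-⊖ n (suc m)) (*-comm _ _)
    zpow-+ -[1+ m ] -[1+ n ] = trans (^-congʳ u (≡.cong suc (≡.sym (ℕ.+-suc m n)))) (^-homo-* u (suc m) (suc n))

    zpow-* : ∀ i n → z (i ℤ.* + n) ≈ z i ^ n
    zpow-* i zero    = reflexive (≡.cong z (ℤ.*-zeroʳ i))
    zpow-* i (suc n) = begin
      z (i ℤ.* + suc n)      ≡⟨ ≡.cong z (ℤ.*-suc i (+ n)) ⟩
      z (i ℤ.+ i ℤ.* + n)    ≈⟨ zpow-+ i (i ℤ.* + n) ⟩
      z i * z (i ℤ.* + n)    ≈⟨ *-congˡ (zpow-* i n) ⟩
      z i ^ suc n            ∎

    zpow-neg-* : ∀ i n → z (ℤ.- (i ℤ.* + n)) ≈ z (ℤ.- i) ^ n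
    zpow-neg-* i n = trans (reflexive (≡.cong z (ℤ.neg-distribˡ-* i (+ n)))) (zpow-* (ℤ.- i) n)

    zpow-inverse : ∀ i → z i * z (ℤ.- i) ≈ 1#
    zpow-inverse i = trans (sym (zpow-+ i (ℤ.- i))) (reflexive (≡.cong z (ℤ.+-inverseʳ i)))

    zpow-∸ : ∀ {k n} → k ℕ.≤ n → z (+ k ℤ.- + n) ≈ u ^ (n ∸ k)
    zpow-∸ {k} {n} k≤n = trans (reflexive (≡.cong z (≡.trans (ℤ.m-n≡m⊖n k n) (ℤ.⊖-≤ k≤n)))) (negative (n ∸ k))
      where
      negative : ∀ m → z (ℤ.- + m) ≈ u ^ m
      negative zero    = refl
      negative (suc m) = refl

  module _ (s : ℕ) (h q : Carrier) (q#0 : q # 0#) (q#1 : q # 1#) where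

    private
      w x p r ρ : Carrier
      w = inverse (1# - q) (#⇒-#0 (#-sym q#1))
      x = h * w
      p = q ^ s
      r = zpow q q#0 (+ s ℤ.- + 1)
      ρ = zpow q q#0 (ℤ.- (+ s ℤ.- + 1))

      W : ℕ → ℕ → Carrier
      W = coeffProduct p 1# ρ (- 1#)

      zpow-p-ρ : ∀ n k → zpow q q#0 (+ s ℤ.* + n ℤ.- (+ s ℤ.- + 1) ℤ.* + k) ≈ p ^ n * ρ ^ k
      zpow-p-ρ n k = trans (zpow-+ q q#0 (+ s ℤ.* + n) (ℤ.- ((+ s ℤ.- + 1) ℤ.* + k)))
        (*-cong (zpow-* q q#0 (+ s) n) (zpow-neg-* q q#0 (+ s ℤ.- + 1) k))

    inverse-q-1 : inverse (q - 1#) (#⇒-#0 q#1) ≈ - 1# * w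
    inverse-q-1 = inverse-unique (q - 1#) (#⇒-#0 q#1) (- 1# * w) (begin
      (q - 1#) * (- 1# * w)
        ≈⟨ solve 3 (λ a m w → a :* (m :* w) := (m :* a) :* w) refl (q - 1#) (- 1#) w ⟩
      (- 1# * (q - 1#)) * w    ≈⟨ *-congʳ (-1*x≈-x (q - 1#)) ⟩
      (- (q - 1#)) * w         ≈⟨ *-congʳ (-‿anti-homo-+ q (- 1#)) ⟩
      (- - 1# - q) * w         ≈⟨ *-congʳ (+-congʳ (-‿involutive 1#)) ⟩
      (1# - q) * w             ≈⟨ *-inverseʳ (1# - q) _ ⟩
      1#                       ∎)

    h*qInt : ∀ i → h * qInt q q#0 q#1 i ≈ x * (1# + - 1# * zpow q q#0 i)
    h*qInt i = begin
      h * ((Z - 1#) * inverse (q - 1#) (#⇒-#0 q#1))  ≈⟨ *-congˡ (*-congˡ inverse-q-1) ⟩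
      h * ((Z - 1#) * (- 1# * w))
        ≈⟨ solve 4 (λ h z m w → h :* ((z :+ m) :* (m :* w)) := (h :* w) :* (m :* m :+ m :* z)) refl h Z (- 1#) w ⟩
      x * (- 1# * - 1# + - 1# * Z)  ≈⟨ *-congˡ (+-congʳ (trans (-1*x≈-x (- 1#)) (-‿involutive 1#))) ⟩
      x * (1# + - 1# * Z)           ∎
      where Z = zpow q q#0 i

    S≈coeffProduct : ∀ n k → S s h q q#0 q#1 n k ≈ x ^ (n ∸ k) * W n k
    S≈coeffProduct zero    zero    = sym (trans (*-identityˡ _) (transform-0 p 1# _))
    S≈coeffProduct zero    (suc k) = sym (trans (*-identityˡ _) (transform-0 p 1# _))
    S≈coeffProduct (suc n) zero    = sym (trans (*-congˡ (coeffProduct-suc-zero p ρ (-‿inverseʳ 1#) n)) (zeroʳ _))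
    S≈coeffProduct (suc n) (suc k) = begin
      S s h q q#0 q#1 (suc n) (suc k)
        ≈⟨ +-cong (*-cong (zpow-p-ρ n k) (S≈coeffProduct n k))
                  (*-cong (trans (h*qInt (+ s ℤ.* + n ℤ.- (+ s ℤ.- + 1) ℤ.* + suc k)) (*-congˡ (+-congˡ (*-congˡ (zpow-p-ρ n (suc k))))))
                          (S≈coeffProduct n (suc k))) ⟩
      (p ^ n * ρ ^ k) * (y * W₀) + (x * (1# + - 1# * (p ^ n * ρ ^ suc k))) * (x ^ (n ∸ suc k) * W₁)
        ≈⟨ +-congˡ (solve 4 (λ x a b c → (x :* a) :* (b :* c) := a :* (x :* (b :* c))) refl
             x (1# + - 1# * (p ^ n * ρ ^ suc k)) (x ^ (n ∸ suc k)) W₁) ⟩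
      (p ^ n * ρ ^ k) * (y * W₀) + (1# + - 1# * (p ^ n * ρ ^ suc k)) * (x * (x ^ (n ∸ suc k) * W₁))
        ≈⟨ +-congˡ (*-congˡ (^-∸-suc x n k (λ n≤k → coeffProduct-above p 1# ρ (- 1#) n (suc k) (s≤s n≤k)))) ⟨
      (p ^ n * ρ ^ k) * (y * W₀) + (1# + - 1# * (p ^ n * ρ ^ suc k)) * (y * W₁)
        ≈⟨ solve 7 (λ a b b′ y v v′ m → (a :* b) :* (y :* v) :+ (con 1 :+ m :* (a :* b′)) :* (y :* v′)
                                      := y :* (con 1 :* v′ :+ a :* (b :* v :+ (m :* b′) :* v′)))
             refl (p ^ n) (ρ ^ k) (ρ ^ suc k) y W₀ W₁ (- 1#) ⟩
      y * (1# * W₁ + p ^ n * (ρ ^ k * W₀ + (- 1# * ρ ^ suc k) * W₁))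
        ≈⟨ *-congˡ (coeffProduct-suc-suc p 1# ρ (- 1#) n k) ⟨
      y * W (suc n) (suc k) ∎
      where
      y  = x ^ (n ∸ k)
      W₀ = W n k
      W₁ = W n (suc k)

    private
      summand : ℕ → ℕ → ℕ → ℕ → ℕ → Carrier
      summand n k t₃ t₂ t₁ =
        (- 1#) ^ ((t₃ ∸ t₂) ℕ.+ (t₁ ∸ k))
        * zpow q q#0 ((+ s ℤ.- + 1) ℤ.* + ((t₁ ∸ k) C 2) ℤ.- (+ s ℤ.- + 1) ℤ.* + (t₁ C 2) ℤ.+ + s ℤ.* + (t₃ C 2))
        * ((t₃ C t₂) × 1#) * ((t₂ C t₁) × 1#)
        * gauss (q ^ s) n t₃
        * gauss (zpow q q#0 (+ s ℤ.- + 1)) t₁ k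

    summand≈coeffs : ∀ n k t₃ t₂ t₁ → summand n k t₃ t₂ t₁ ≈
      (coeff p 1# n t₃ * coeff 1# (- 1#) t₃ t₂) * (coeff 1# 1# t₂ t₁ * coeff ρ (- 1#) t₁ k)
    summand≈coeffs n k t₃ t₂ t₁ = begin
      summand n k t₃ t₂ t₁
        ≈⟨ *-congʳ (*-congʳ (*-congʳ (*-congʳ (*-cong (^-homo-* (- 1#) (t₃ ∸ t₂) (t₁ ∸ k)) powers)))) ⟩
      (m₁ * m₂) * ((R * P₁) * P₃) * C₁ * C₂ * G₁ * G₂
        ≈⟨ solve 9 (λ m₁ m₂ a b c C₁ C₂ g₁ g₂ →
             (m₁ :* m₂) :* ((a :* b) :* c) :* C₁ :* C₂ :* g₁ :* g₂
             := ((con 1 :* (c :* g₁)) :* (m₁ :* C₁)) :* ((con 1 :* C₂) :* (m₂ :* (a :* b :* g₂))))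
             refl m₁ m₂ R P₁ P₃ C₁ C₂ G₁ G₂ ⟩
      ((1# * (P₃ * G₁)) * (m₁ * C₁)) * ((1# * C₂) * (m₂ * (R * P₁ * G₂)))
        ≈⟨ *-cong (*-congʳ (*-congʳ (1^n≈1 (n ∸ t₃)))) (*-congʳ (*-congʳ (1^n≈1 (t₂ ∸ t₁)))) ⟨
      ((1# ^ (n ∸ t₃) * (P₃ * G₁)) * (m₁ * C₁)) * ((1# ^ (t₂ ∸ t₁) * C₂) * (m₂ * (R * P₁ * G₂)))
        ≈⟨ *-cong (*-cong (coeff≈gauss p 1# n t₃) (coeff-1≈C (- 1#) t₃ t₂))
                  (*-cong (coeff-1≈C 1# t₂ t₁)
                          (coeff-inverse≈gauss (zpow-inverse q q#0 (+ s ℤ.- + 1)) (- 1#) t₁ k)) ⟨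
      (coeff p 1# n t₃ * coeff 1# (- 1#) t₃ t₂) * (coeff 1# 1# t₂ t₁ * coeff ρ (- 1#) t₁ k) ∎
      where
      m₁ = (- 1#) ^ (t₃ ∸ t₂)
      m₂ = (- 1#) ^ (t₁ ∸ k)
      R  = r ^ ((t₁ ∸ k) C 2)
      P₁ = ρ ^ (t₁ C 2)
      P₃ = p ^ (t₃ C 2)
      C₁ = (t₃ C t₂) × 1#
      C₂ = (t₂ C t₁) × 1#
      G₁ = gauss p n t₃
      G₂ = gauss r t₁ k
      i₁ = (+ s ℤ.- + 1) ℤ.* + ((t₁ ∸ k) C 2)
      i₂ = ℤ.- ((+ s ℤ.- + 1) ℤ.* + (t₁ C 2))
      i₃ = + s ℤ.* + (t₃ C 2)
      powers : zpow q q#0 (i₁ ℤ.+ i₂ ℤ.+ i₃) ≈ (R * P₁) * P₃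
      powers = trans (zpow-+ q q#0 (i₁ ℤ.+ i₂) i₃) (*-cong
        (trans (zpow-+ q q#0 i₁ i₂)
               (*-cong (zpow-* q q#0 (+ s ℤ.- + 1) ((t₁ ∸ k) C 2)) (zpow-neg-* q q#0 (+ s ℤ.- + 1) (t₁ C 2))))
        (zpow-* q q#0 (+ s) (t₃ C 2)))

    sum-summand : ∀ {n k} → k ℕ.≤ n →
      (Σ[ k ≤ t₃ ≤ n ] Σ[ k ≤ t₂ ≤ t₃ ] Σ[ k ≤ t₁ ≤ t₂ ] summand n k t₃ t₂ t₁) ≈ W n k
    sum-summand {n} {k} k≤n = begin
      (Σ[ k ≤ t₃ ≤ n ] Σ[ k ≤ t₂ ≤ t₃ ] Σ[ k ≤ t₁ ≤ t₂ ] summand n k t₃ t₂ t₁)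
        ≈⟨ transform-from p 1# 1# D _ k≤n
             (λ t t<k → trans (inversion t) (A-below t t<k))
             (λ t₃ k≤t₃ → trans (over-t₂ t₃ k≤t₃) (sym (*-identityˡ _))) ⟩
      1# * transform p 1# D n  ≈⟨ *-identityˡ _ ⟩
      transform p 1# D n       ≈⟨ transform-cong p 1# n inversion ⟩
      W n k                    ∎
      where
      A B D : ℕ → Carrier
      A t = coeff ρ (- 1#) t k
      B = transform 1# 1# A
      D = transform 1# (- 1#) B

      A-below : ∀ t → t ℕ.< k → A t ≈ 0#
      A-below t = coeff-above ρ (- 1#) t k

      inversion : ∀ t → D t ≈ A t
      inversion = binomial-inversion (-‿inverseˡ 1#) A

      over-t₁ : ∀ t₃ t₂ → k ℕ.≤ t₂ →
        (Σ[ k ≤ t₁ ≤ t₂ ] summand n k t₃ t₂ t₁) ≈ coeff p 1# n t₃ * (coeff 1# (- 1#) t₃ t₂ * B t₂)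
      over-t₁ t₃ t₂ k≤t₂ = trans
        (transform-from 1# 1# _ A (summand n k t₃ t₂) k≤t₂ A-below (λ t₁ _ → summand≈coeffs n k t₃ t₂ t₁))
        (*-assoc _ _ _)

      over-t₂ : ∀ t₃ → k ℕ.≤ t₃ →
        (Σ[ k ≤ t₂ ≤ t₃ ] Σ[ k ≤ t₁ ≤ t₂ ] summand n k t₃ t₂ t₁) ≈ coeff p 1# n t₃ * D t₃
      over-t₂ t₃ k≤t₃ = transform-from 1# (- 1#) _ B _ k≤t₃
        (λ t t<k → transform-zero 1# 1# t (λ t′ t′≤t → A-below t′ (ℕ.≤-<-trans t′≤t t<k)))
        (over-t₁ t₃)

    S≈sum-summand : ∀ {n k} → k ℕ.≤ n → S s h q q#0 q#1 n k
      ≈ h ^ (n ∸ k) * zpow (1# - q) (#⇒-#0 (#-sym q#1)) (+ k ℤ.- + n) *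
        (Σ[ k ≤ t₃ ≤ n ] Σ[ k ≤ t₂ ≤ t₃ ] Σ[ k ≤ t₁ ≤ t₂ ] summand n k t₃ t₂ t₁)
    S≈sum-summand {n} {k} k≤n = trans (S≈coeffProduct n k) (*-cong
      (trans (^-distrib-* h w (n ∸ k)) (*-congˡ (sym (zpow-∸ (1# - q) (#⇒-#0 (#-sym q#1)) k≤n))))
      (sym (sum-summand k≤n)))

corollary8 : ∀ {c ℓ₁ ℓ₂} (F : HeytingField c ℓ₁ ℓ₂) →
  let open HeytingField F
      open OverField F
  in
  (s : ℕ) (h q : Carrier) (h#0 : h # 0#) (q#0 : q # 0#) (q#1 : q # 1#) →
  (n k : ℕ) → k ℕ.≤ n →
  S s h q q#0 q#1 n k
    ≈ h ^ (n ∸ k) * zpow (1# - q) (#⇒-#0 (#-sym q#1)) (+ k ℤ.- + n) *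
      (Σ[ k ≤ t₃ ≤ n ] Σ[ k ≤ t₂ ≤ t₃ ] Σ[ k ≤ t₁ ≤ t₂ ]
         ((- 1#) ^ ((t₃ ∸ t₂) ℕ.+ (t₁ ∸ k))
          * zpow q q#0 ((+ s ℤ.- + 1) ℤ.* + ((t₁ ∸ k) C 2) ℤ.- (+ s ℤ.- + 1) ℤ.* + (t₁ C 2) ℤ.+ + s ℤ.* + (t₃ C 2))
          * ((t₃ C t₂) × 1#) * ((t₂ C t₁) × 1#)
          * gauss (q ^ s) n t₃
          * gauss (zpow q q#0 (+ s ℤ.- + 1)) t₁ k))
corollary8 F s h q h#0 q#0 q#1 n k k≤n = NormalOrdering.S≈sum-summand F s h q q#0 q#1 k≤n
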